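{- The assignments $\mathbf{L}\mapsto\mathbf{R}(\mathbf{L})$ (from orthomodular lattices to orthomodular near semirings) and $\mathbf{R}\mapsto\mathbf{L}(\mathbf{R})$ (from orthomodular near semirings to orthomodular lattices) are mutually inverse: $\mathbf{L}=\mathbf{L}(\mathbf{R}(\mathbf{L}))$ for every orthomodular lattice $\mathbf{L}$, and $\mathbf{R}=\mathbf{R}(\mathbf{L}(\mathbf{R}))$ for every orthomodular near semiring $\mathbf{R}$ (equality of all operations on the same universe).
   Context: A near semiring is an algebra $\langle R,+,\cdot,0,1\rangle$ such that: (i) $\langle R,+,0\rangle$ is a commutative monoid; (ii) $x\cdot 1=x=1\cdot x$ (multiplication need not be associative or commutative); (iii) $(x+y)\cdot z=(x\cdot z)+(y\cdot z)$; (iv) $x\cdot 0=0\cdot x=0$. It is idempotent if $x+x=x$; then $x\le y$ iff $x+y=y$ defines a partial order, called the induced order. An involutive near semiring is an idempotent near semiring with a map $\alpha:R\to R$ such that $\alpha(\alpha(x))=x$, and $x\le y$ implies $\alpha(y)\le\alpha(x)$. A Łukasiewicz near semiring is an involutive near semiring satisfying the identity $\alpha(x\cdot\alpha(y))\cdot\alpha(y)=\alpha(y\cdot\alpha(x))\cdot\alpha(x)$. An orthomodular near semiring is a Łukasiewicz near semiring satisfying the identity $x=x\cdot(x+y)$. An orthomodular lattice is an algebra $\langle L,\vee,\wedge,{}',0,1\rangle$ such that $\langle L,\vee,\wedge,0,1\rangle$ is a bounded lattice, $x\wedge x'=0$, $x\vee x'=1$, $x''=x$, $x\le y$ implies $y'\le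 x'$, and $x\le y$ implies $y=x\vee(y\wedge x')$. For an orthomodular lattice $\mathbf{L}$, $\mathbf{R}(\mathbf{L})=\langle L,+,\cdot,{}',0,1\rangle$ where $x+y=x\vee y$, $x\cdot y=(x\vee y')\wedge y$ and $\alpha(x)=x'$; it is an orthomodular near semiring. For an orthomodular near semiring $\mathbf{R}=\langle R,+,\cdot,0,1,\alpha\rangle$, $\mathbf{L}(\mathbf{R})=\langle R,\vee,\wedge,{}',0,1\rangle$ where $x\vee y=x+y$, $x'=\alpha(x)$, $x\wedge y=(x'\vee y')'$; it is an orthomodular lattice. -}

module Defs where

open import Level using (Level; _⊔_)
open import Data.Product using (_,_; proj₁; proj₂)
open import Algebra.Core using (Op₁; Op₂)
open import Relation.Binary.Core using (Rel)
open import Relation.Binary.Bundles using (Setoid)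
import Algebra.Definitions as Definitions
import Algebra.Structures as Structures
open import Algebra.Lattice.Bundles using (Lattice)
import Algebra.Lattice.Structures as LatticeStructures
import Algebra.Lattice.Properties.Lattice as LatticeProperties
import Relation.Binary.Reasoning.Setoid as SetoidReasoning

private
  variable
    c ℓ : Level

-- A universe is a setoid S, whose _≈_ plays the role of equality.  Algebras
-- are structures on a given S, so that two of them can share a universe.

module _ (S : Setoid c ℓ) where

  open Setoid S using (_≈_) renaming (Carrier to A)
  open Definitions _≈_
  open Structures _≈_
    using (IsCommutativeMonoid; IsIdempotentCommutativeMonoid)
  open LatticeStructures _≈_ using (IsLattice)

  -- The order induced by an idempotent operation.  The stdlib natural orders
  -- orient the defining equation differently.
  InducedOrder : Op₂ A → Rel A ℓ
  InducedOrder _+_ x y = (x + y) ≈ y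

  -- Unlike IsNearSemiring of the standard library, _*_ need not be
  -- associative, while _+_ is commutative and there is a unit.
  record IsNearSemiring (_+_ _*_ : Op₂ A) (0# 1# : A) : Set (c ⊔ ℓ) where
    field
      +-isCommutativeMonoid : IsCommutativeMonoid _+_ 0#
      *-cong                : Congruent₂ _*_
      *-identity            : Identity 1# _*_
      distribʳ              : _*_ DistributesOverʳ _+_
      zero                  : Zero 0# _*_

  record IsIdempotentNearSemiring (_+_ _*_ : Op₂ A) (0# 1# : A)
         : Set (c ⊔ ℓ) where
    field
      isNearSemiring : IsNearSemiring _+_ _*_ 0# 1#
      +-idem         : Idempotent _+_
    open IsNearSemiring isNearSemiring public

    infix 4 _≤_
    _≤_ : Rel A ℓ
    _≤_ = InducedOrder _+_

  record IsInvolutiveNearSemiring (_+_ _*_ : Op₂ A) (α : Op₁ A) (0# 1# : A)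
         : Set (c ⊔ ℓ) where
    field
      isIdempotentNearSemiring : IsIdempotentNearSemiring _+_ _*_ 0# 1#
    open IsIdempotentNearSemiring isIdempotentNearSemiring public
    field
      α-cong       : Congruent₁ α
      α-involutive : Involutive α
      α-antitone   : ∀ {x y} → x ≤ y → α y ≤ α x

  record IsŁukasiewiczNearSemiring (_+_ _*_ : Op₂ A) (α : Op₁ A) (0# 1# : A)
         : Set (c ⊔ ℓ) where
    field
      isInvolutiveNearSemiring : IsInvolutiveNearSemiring _+_ _*_ α 0# 1#
      łukasiewicz : ∀ x y → (α (x * α y) * α y) ≈ (α (y * α x) * α x)
    open IsInvolutiveNearSemiring isInvolutiveNearSemiring public

  record IsOrthomodularNearSemiring (_+_ _*_ : Op₂ A) (α : Op₁ A) (0# 1# : A)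
         : Set (c ⊔ ℓ) where
    field
      isŁukasiewiczNearSemiring : IsŁukasiewiczNearSemiring _+_ _*_ α 0# 1#
      orthomodular              : ∀ x y → x ≈ (x * (x + y))
    open IsŁukasiewiczNearSemiring isŁukasiewiczNearSemiring public

  record IsBoundedLattice (_∨_ _∧_ : Op₂ A) (⊥ ⊤ : A) : Set (c ⊔ ℓ) where
    field
      isLattice  : IsLattice _∨_ _∧_
      ∨-identity : Identity ⊥ _∨_
      ∧-identity : Identity ⊤ _∧_
    open IsLattice isLattice public

    infix 4 _≤_
    _≤_ : Rel A ℓ
    _≤_ = InducedOrder _∨_

  record IsOrthomodularLattice (_∨_ _∧_ : Op₂ A) (_′ : Op₁ A) (⊥ ⊤ : A)
         : Set (c ⊔ ℓ) where
    field
      isBoundedLattice : IsBoundedLattice _∨_ _∧_ ⊥ ⊤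
    open IsBoundedLattice isBoundedLattice public
    field
      ′-cong       : Congruent₁ _′
      ∧-complement : ∀ x → (x ∧ (x ′)) ≈ ⊥
      ∨-complement : ∀ x → (x ∨ (x ′)) ≈ ⊤
      ′-involutive : Involutive _′
      ′-antitone   : ∀ {x y} → x ≤ y → (y ′) ≤ (x ′)
      orthomodular : ∀ {x y} → x ≤ y → y ≈ (x ∨ (y ∧ (x ′)))

  record OrthomodularNearSemiring : Set (c ⊔ ℓ) where
    infixl 7 _*_
    infixl 6 _+_
    field
      _+_ _*_ : Op₂ A
      α       : Op₁ A
      0# 1#   : A
      isOrthomodularNearSemiring : IsOrthomodularNearSemiring _+_ _*_ α 0# 1#
    open IsOrthomodularNearSemiring isOrthomodularNearSemiring public

  record OrthomodularLattice : Set (c ⊔ ℓ) where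
    infix  8 _′
    infixr 7 _∧_
    infixr 6 _∨_
    field
      _∨_ _∧_ : Op₂ A
      _′      : Op₁ A
      ⊥ ⊤     : A
      isOrthomodularLattice : IsOrthomodularLattice _∨_ _∧_ _′ ⊥ ⊤
    open IsOrthomodularLattice isOrthomodularLattice public

  module JoinOrder {_∨_ : Op₂ A} {⊥ : A}
                   (isICM : IsIdempotentCommutativeMonoid _∨_ ⊥) where
    open Setoid S using (refl; sym; trans)
    open IsIdempotentCommutativeMonoid isICM public
      using (assoc; comm; ∙-cong; ∙-congˡ; ∙-congʳ; idem; identityˡ; identityʳ)
    open SetoidReasoning S

    private
      infix 4 _≤_
      _≤_ : Rel A ℓ
      _≤_ = InducedOrder _∨_

    ≤-reflexive : ∀ {x y} → x ≈ y → x ≤ y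
    ≤-reflexive x≈y = trans (∙-congʳ x≈y) (idem _)

    ≤-trans : ∀ {x y z} → x ≤ y → y ≤ z → x ≤ z
    ≤-trans {x} {y} {z} x≤y y≤z = begin
      x ∨ z        ≈⟨ ∙-congˡ y≤z ⟨
      x ∨ (y ∨ z)  ≈⟨ assoc x y z ⟨
      (x ∨ y) ∨ z  ≈⟨ ∙-congʳ x≤y ⟩
      y ∨ z        ≈⟨ y≤z ⟩
      z            ∎

    ≤-antisym : ∀ {x y} → x ≤ y → y ≤ x → x ≈ y
    ≤-antisym x≤y y≤x = trans (sym y≤x) (trans (comm _ _) x≤y)

    x≤x∨y : ∀ x y → x ≤ (x ∨ y)
    x≤x∨y x y = trans (sym (assoc x x y)) (∙-congʳ (idem x))

    y≤x∨y : ∀ x y → y ≤ (x ∨ y)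
    y≤x∨y x y = ≤-trans (x≤x∨y y x) (≤-reflexive (comm y x))

    ∨-least : ∀ {x y z} → x ≤ z → y ≤ z → (x ∨ y) ≤ z
    ∨-least x≤z y≤z = trans (assoc _ _ _) (trans (∙-congˡ y≤z) x≤z)

    ∨-mono : ∀ {x y u v} → x ≤ u → y ≤ v → (x ∨ y) ≤ (u ∨ v)
    ∨-mono x≤u y≤v =
      ∨-least (≤-trans x≤u (x≤x∨y _ _)) (≤-trans y≤v (y≤x∨y _ _))

    ⊥≤x : ∀ x → ⊥ ≤ x
    ⊥≤x = identityˡ

module _ {S : Setoid c ℓ} where

  open Setoid S using (_≈_; refl; sym; trans; isEquivalence)
    renaming (Carrier to A)
  open Definitions _≈_
  open Structures _≈_
  open LatticeStructures _≈_ using (IsLattice)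
  open SetoidReasoning S

  module OrthomodularLatticeProperties (L : OrthomodularLattice S) where
    open OrthomodularLattice L
      hiding (isEquivalence; refl; sym; trans; reflexive)

    lattice : Lattice c ℓ
    lattice = record { isLattice = isLattice }

    open LatticeProperties lattice using (∨-isSemigroup; ∨-idem; ∧-idem)

    ∨-isIdempotentCommutativeMonoid : IsIdempotentCommutativeMonoid _∨_ ⊥
    ∨-isIdempotentCommutativeMonoid = record
      { isCommutativeMonoid = record
        { isMonoid = record
          { isSemigroup = ∨-isSemigroup
          ; identity    = ∨-identity
          }
        ; comm = ∨-comm
        }
      ; idem = ∨-idem
      }

    open JoinOrder S ∨-isIdempotentCommutativeMonoid public

    x∧y≤x : ∀ x y → x ∧ y ≤ x
    x∧y≤x x y = trans (∨-comm _ _) (∨-absorbs-∧ x y)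

    x∧y≤y : ∀ x y → x ∧ y ≤ y
    x∧y≤y x y = ≤-trans (≤-reflexive (∧-comm x y)) (x∧y≤x y x)

    ≤⇒∧ : ∀ {x y} → x ≤ y → x ∧ y ≈ x
    ≤⇒∧ {x} {y} x≤y = trans (∧-congˡ (sym x≤y)) (∧-absorbs-∨ x y)

    ∧-greatest : ∀ {x y z} → z ≤ x → z ≤ y → z ≤ x ∧ y
    ∧-greatest {x} {y} {z} z≤x z≤y = ≤-trans (≤-reflexive z≈) (x∧y≤y z (x ∧ y))
      where
      z≈ : z ≈ z ∧ (x ∧ y)
      z≈ = begin
        z            ≈⟨ ≤⇒∧ z≤y ⟨
        z ∧ y        ≈⟨ ∧-congʳ (≤⇒∧ z≤x) ⟨
        (z ∧ x) ∧ y  ≈⟨ ∧-assoc z x y ⟩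
        z ∧ (x ∧ y)  ∎

    ∧-monoˡ : ∀ {x y} z → x ≤ y → x ∧ z ≤ y ∧ z
    ∧-monoˡ z x≤y = ∧-greatest (≤-trans (x∧y≤x _ z) x≤y) (x∧y≤y _ z)

    x≤⊤ : ∀ x → x ≤ ⊤
    x≤⊤ x = ≤-trans (≤-reflexive (sym (proj₂ ∧-identity x))) (x∧y≤y x ⊤)

    ≤-swap : ∀ {x y} → x ≤ y ′ → y ≤ x ′
    ≤-swap x≤y′ = ≤-trans (≤-reflexive (sym (′-involutive _))) (′-antitone x≤y′)

    ⊤′≈⊥ : ⊤ ′ ≈ ⊥
    ⊤′≈⊥ = trans (sym (proj₁ ∧-identity _)) (∧-complement ⊤)

    orthomodular-dual : ∀ {x y} → x ≤ y → (x ∨ y ′) ∧ y ≈ x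
    orthomodular-dual {x} {y} x≤y = begin
      m              ≈⟨ orthomodular x≤m ⟩
      x ∨ m ∧ x ′    ≈⟨ ∨-congˡ (≤-antisym p≤⊥ (⊥≤x _)) ⟩
      x ∨ ⊥          ≈⟨ identityʳ x ⟩
      x              ∎
      where
      m = (x ∨ y ′) ∧ y
      p = m ∧ x ′
      q = y ∧ x ′
      x≤m : x ≤ m
      x≤m = ∧-greatest (x≤x∨y x (y ′)) x≤y
      p≤q : p ≤ q
      p≤q = ∧-monoˡ (x ′) (x∧y≤y _ y)
      p≤q′ : p ≤ q ′
      p≤q′ = ≤-trans (≤-trans (x∧y≤x m (x ′)) (x∧y≤x _ y))
               (∨-least (≤-swap (x∧y≤y y (x ′))) (′-antitone (x∧y≤x y (x ′))))
      p≤⊥ : p ≤ ⊥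
      p≤⊥ = ≤-trans (∧-greatest p≤q p≤q′) (≤-reflexive (∧-complement q))

    sasaki : Op₂ A
    sasaki x y = (x ∨ y ′) ∧ y

    sasaki-cong : Congruent₂ sasaki
    sasaki-cong x≈u y≈v = ∧-cong (∨-cong x≈u (′-cong y≈v)) y≈v

    sasaki-identity : Identity ⊤ sasaki
    sasaki-identity =
      (λ x → trans (∧-congʳ (≤-antisym (x≤⊤ _) (x≤x∨y ⊤ (x ′))))
                   (proj₁ ∧-identity x)) ,
      (λ x → trans (proj₂ ∧-identity _)
                   (trans (∨-congˡ ⊤′≈⊥) (identityʳ x)))

    sasaki-zero : Zero ⊥ sasaki
    sasaki-zero =
      (λ x → trans (∧-congʳ (identityˡ _))
                   (trans (∧-comm _ _) (∧-complement x))) ,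
      (λ x → ≤-antisym (x∧y≤y _ ⊥) (⊥≤x _))

    sasaki-mono : ∀ {x y} z → x ≤ y → sasaki x z ≤ sasaki y z
    sasaki-mono z x≤y = ∧-monoˡ z (∨-mono x≤y (≤-reflexive refl))

    x≤sasaki∨′ : ∀ x z → x ≤ sasaki x z ∨ z ′
    x≤sasaki∨′ x z = ≤-trans (x≤x∨y x (z ′)) (≤-reflexive (begin
      x ∨ z ′                          ≈⟨ orthomodular (y≤x∨y x (z ′)) ⟩
      z ′ ∨ (x ∨ z ′) ∧ z ′ ′          ≈⟨ ∨-comm _ _ ⟩
      (x ∨ z ′) ∧ z ′ ′ ∨ z ′          ≈⟨ ∨-congʳ (∧-congˡ (′-involutive z)) ⟩
      (x ∨ z ′) ∧ z ∨ z ′              ∎))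

    sasaki-distribʳ-∨ : sasaki DistributesOverʳ _∨_
    sasaki-distribʳ-∨ z x y = ≤-antisym
      (≤-trans (∧-monoˡ z (∨-least (∨-least x≤ y≤) (y≤x∨y w (z ′))))
               (≤-reflexive (orthomodular-dual w≤z)))
      (∨-least (sasaki-mono z (x≤x∨y x y)) (sasaki-mono z (y≤x∨y x y)))
      where
      w = sasaki x z ∨ sasaki y z
      w≤z : w ≤ z
      w≤z = ∨-least (x∧y≤y _ z) (x∧y≤y _ z)
      x≤ : x ≤ w ∨ z ′
      x≤ = ≤-trans (x≤sasaki∨′ x z) (∨-mono (x≤x∨y _ _) (≤-reflexive refl))
      y≤ : y ≤ w ∨ z ′
      y≤ = ≤-trans (x≤sasaki∨′ y z) (∨-mono (y≤x∨y _ _) (≤-reflexive refl))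

    sasaki-′ : ∀ x y → sasaki (sasaki x (y ′) ′) (y ′) ≈ (x ∨ y) ′
    sasaki-′ x y = begin
      (((x ∨ y ′ ′) ∧ y ′) ′ ∨ y ′ ′) ∧ y ′
        ≈⟨ ∧-congʳ (∨-congʳ (′-cong (∧-congʳ (∨-congˡ (′-involutive y))))) ⟩
      (((x ∨ y) ∧ y ′) ′ ∨ y ′ ′) ∧ y ′
        ≈⟨ ∧-congʳ (≤-antisym (∨-least below (y≤x∨y _ _))
                              (∨-mono (′-antitone (x∧y≤x _ _)) (≤-reflexive refl))) ⟩
      ((x ∨ y) ′ ∨ y ′ ′) ∧ y ′
        ≈⟨ orthomodular-dual (′-antitone (y≤x∨y x y)) ⟩
      (x ∨ y) ′ ∎
      where
      r = (x ∨ y) ′ ∨ y ′ ′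
      below : ((x ∨ y) ∧ y ′) ′ ≤ r
      below = ≤-trans
        (′-antitone (∧-greatest
          (≤-trans (′-antitone (x≤x∨y _ _)) (≤-reflexive (′-involutive _)))
          (≤-trans (′-antitone (y≤x∨y _ _)) (≤-reflexive (′-involutive _)))))
        (≤-reflexive (′-involutive r))

  module OrthomodularNearSemiringProperties (R : OrthomodularNearSemiring S) where
    open OrthomodularNearSemiring R

    +-isIdempotentCommutativeMonoid : IsIdempotentCommutativeMonoid _+_ 0#
    +-isIdempotentCommutativeMonoid = record
      { isCommutativeMonoid = +-isCommutativeMonoid
      ; idem                = +-idem
      }

    open JoinOrder S +-isIdempotentCommutativeMonoid public

    infixr 7 _⊓_
    _⊓_ : Op₂ A
    x ⊓ y = α (α x + α y)

    *-monoˡ : ∀ {x y} z → x ≤ y → x * z ≤ y * z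
    *-monoˡ {x} {y} z x≤y = trans (sym (distribʳ z x y)) (*-cong x≤y refl)

    ≤⇒* : ∀ {x y} → x ≤ y → x * y ≈ x
    ≤⇒* x≤y = trans (*-cong refl (sym x≤y)) (sym (orthomodular _ _))

    x≤1 : ∀ x → x ≤ 1#
    x≤1 x = trans (comm x 1#)
              (sym (trans (orthomodular 1# x) (proj₁ *-identity _)))

    *≤ʳ : ∀ x y → x * y ≤ y
    *≤ʳ x y = ≤-trans (*-monoˡ y (x≤1 x)) (≤-reflexive (proj₁ *-identity y))

    α-swap : ∀ {x y} → α x ≤ y → α y ≤ x
    α-swap αx≤y = ≤-trans (α-antitone αx≤y) (≤-reflexive (α-involutive _))

    α0≈1 : α 0# ≈ 1#
    α0≈1 = ≤-antisym (x≤1 _)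
      (≤-trans (≤-reflexive (sym (α-involutive 1#))) (α-antitone (⊥≤x _)))

    α1≈0 : α 1# ≈ 0#
    α1≈0 = trans (α-cong (sym α0≈1)) (α-involutive 0#)

    ⊓≤ˡ : ∀ x y → x ⊓ y ≤ x
    ⊓≤ˡ x y = α-swap (x≤x∨y _ _)

    ⊓≤ʳ : ∀ x y → x ⊓ y ≤ y
    ⊓≤ʳ x y = α-swap (y≤x∨y _ _)

    ⊓-greatest : ∀ {x y z} → z ≤ x → z ≤ y → z ≤ x ⊓ y
    ⊓-greatest z≤x z≤y = ≤-trans (≤-reflexive (sym (α-involutive _)))
      (α-antitone (∨-least (α-antitone z≤x) (α-antitone z≤y)))

    ⊓-cong : Congruent₂ _⊓_
    ⊓-cong x≈u y≈v = α-cong (∙-cong (α-cong x≈u) (α-cong y≈v))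

    ⊓-isLattice : IsLattice _+_ _⊓_
    ⊓-isLattice = record
      { isEquivalence = isEquivalence
      ; ∨-comm        = comm
      ; ∨-assoc       = assoc
      ; ∨-cong        = ∙-cong
      ; ∧-comm        = λ x y → α-cong (comm _ _)
      ; ∧-assoc       = λ x y z → α-cong (begin
          α (x ⊓ y) + α z      ≈⟨ ∙-congʳ (α-involutive _) ⟩
          (α x + α y) + α z    ≈⟨ assoc _ _ _ ⟩
          α x + (α y + α z)    ≈⟨ ∙-congˡ (α-involutive _) ⟨
          α x + α (y ⊓ z)      ∎)
      ; ∧-cong        = ⊓-cong
      ; absorptive    =
          (λ x y → trans (comm _ _) (⊓≤ˡ x y)) ,
          (λ x y → ≤-antisym (⊓≤ˡ x _)
                     (⊓-greatest (≤-reflexive refl) (x≤x∨y x y)))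
      }

    x*αx≈0 : ∀ x → x * α x ≈ 0#
    x*αx≈0 x = begin
      x * α x                    ≈⟨ *-cong (trans (α-cong (proj₁ *-identity _)) (α-involutive x)) refl ⟨
      α (1# * α x) * α x         ≈⟨ łukasiewicz x 1# ⟨
      α (x * α 1#) * α 1#        ≈⟨ *-cong refl α1≈0 ⟩
      α (x * α 1#) * 0#          ≈⟨ proj₂ zero _ ⟩
      0#                         ∎

    αx*x≈0 : ∀ x → α x * x ≈ 0#
    αx*x≈0 x = trans (*-cong refl (sym (α-involutive x))) (x*αx≈0 (α x))

    +-complement : ∀ x → x + α x ≈ 1#
    +-complement x = begin
      c′         ≈⟨ α-involutive c′ ⟨
      α (α c′)   ≈⟨ α-cong αc≈0 ⟩
      α 0#       ≈⟨ α0≈1 ⟩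
      1#         ∎
      where
      c′ = x + α x
      αc≤c : α c′ ≤ c′
      αc≤c = ≤-trans (α-antitone (x≤x∨y x (α x))) (y≤x∨y x (α x))
      αc≈0 : α c′ ≈ 0#
      αc≈0 = trans (sym (≤⇒* αc≤c)) (αx*x≈0 c′)

    ⊓-complement : ∀ x → x ⊓ α x ≈ 0#
    ⊓-complement x = trans (α-cong (+-complement (α x))) α1≈0

    -- The instance of the Łukasiewicz identity for comparable elements.
    ≤⇒*-comm : ∀ {x y} → x ≤ y → y * α x ≈ α x * y
    ≤⇒*-comm {x} {y} x≤y = begin
      y * α x                    ≈⟨ *-cong (α-involutive y) refl ⟨
      α (α y) * α x              ≈⟨ *-cong (α-cong (≤⇒* (α-antitone x≤y))) refl ⟨
      α (α y * α x) * α x        ≈⟨ łukasiewicz (α y) x ⟩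
      α (x * α (α y)) * α (α y)  ≈⟨ *-cong (α-cong (*-cong refl (α-involutive y))) (α-involutive y) ⟩
      α (x * y) * y              ≈⟨ *-cong (α-cong (≤⇒* x≤y)) refl ⟩
      α x * y                    ∎

    disjoint⇒≈ : ∀ {x y} → x ≤ y → y ⊓ α x ≤ 0# → y ≈ x
    disjoint⇒≈ {x} {y} x≤y y⊓αx≤0 = begin
      y                  ≈⟨ proj₁ *-identity y ⟨
      1# * y             ≈⟨ *-cong (+-complement x) refl ⟨
      (x + α x) * y      ≈⟨ distribʳ y x (α x) ⟩
      x * y + α x * y    ≈⟨ ∙-cong (≤⇒* x≤y) αx*y≈0 ⟩
      x + 0#             ≈⟨ identityʳ x ⟩
      x                  ∎
      where
      αx*y≈0 : α x * y ≈ 0#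
      αx*y≈0 = ≤-antisym
        (≤-trans (⊓-greatest (*≤ʳ (α x) y)
                   (≤-trans (≤-reflexive (sym (≤⇒*-comm x≤y))) (*≤ʳ y (α x))))
                 y⊓αx≤0)
        (⊥≤x _)

    ⊓-orthomodular : ∀ {x y} → x ≤ y → y ≈ x + y ⊓ α x
    ⊓-orthomodular {x} {y} x≤y =
      disjoint⇒≈ (∨-least x≤y (⊓≤ˡ y (α x)))
        (≤-trans (⊓-greatest below₁ below₂) (≤-reflexive (⊓-complement d)))
      where
      d = y ⊓ α x
      e = x + d
      below₁ : y ⊓ α e ≤ d
      below₁ = ⊓-greatest (⊓≤ˡ y (α e))
                 (≤-trans (⊓≤ʳ y (α e)) (α-antitone (x≤x∨y x d)))
      below₂ : y ⊓ α e ≤ α d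
      below₂ = ≤-trans (⊓≤ʳ y (α e)) (α-antitone (y≤x∨y x d))

  𝐑 : OrthomodularLattice S → OrthomodularNearSemiring S
  𝐑 L = record
    { _+_ = _∨_
    ; _*_ = λ x y → (x ∨ y ′) ∧ y
    ; α   = _′
    ; 0#  = ⊥
    ; 1#  = ⊤
    ; isOrthomodularNearSemiring = record
      { isŁukasiewiczNearSemiring = record
        { isInvolutiveNearSemiring = record
          { isIdempotentNearSemiring = record
            { isNearSemiring = record
              { +-isCommutativeMonoid =
                  IsIdempotentCommutativeMonoid.isCommutativeMonoid
                    ∨-isIdempotentCommutativeMonoid
              ; *-cong                = sasaki-cong
              ; *-identity            = sasaki-identity
              ; distribʳ              = sasaki-distribʳ-∨
              ; zero                  = sasaki-zero
              }
            ; +-idem = idem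
            }
          ; α-cong       = ′-cong
          ; α-involutive = ′-involutive
          ; α-antitone   = ′-antitone
          }
        ; łukasiewicz = λ x y → trans (sasaki-′ x y)
            (trans (′-cong (∨-comm x y)) (sym (sasaki-′ y x)))
        }
      ; orthomodular = λ x y → sym (orthomodular-dual (x≤x∨y x y))
      }
    }
    where
    open OrthomodularLattice L using
      ( _∨_; _∧_; _′; ⊥; ⊤; ∨-comm; ′-cong; ′-involutive; ′-antitone )
    open OrthomodularLatticeProperties L

  𝐋 : OrthomodularNearSemiring S → OrthomodularLattice S
  𝐋 R = record
    { _∨_ = _+_
    ; _∧_ = λ x y → α (α x + α y)
    ; _′  = α
    ; ⊥   = 0#
    ; ⊤   = 1#
    ; isOrthomodularLattice = record
      { isBoundedLattice = record
        { isLattice  = ⊓-isLattice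
        ; ∨-identity = identityˡ , identityʳ
        ; ∧-identity =
            (λ x → ≤-antisym (⊓≤ʳ 1# x)
                     (⊓-greatest (x≤1 x) (≤-reflexive refl))) ,
            (λ x → ≤-antisym (⊓≤ˡ x 1#)
                     (⊓-greatest (≤-reflexive refl) (x≤1 x)))
        }
      ; ′-cong       = α-cong
      ; ∧-complement = ⊓-complement
      ; ∨-complement = +-complement
      ; ′-involutive = α-involutive
      ; ′-antitone   = α-antitone
      ; orthomodular = ⊓-orthomodular
      }
    }
    where
    open OrthomodularNearSemiring R using
      ( _+_; α; 0#; 1#; α-cong; α-involutive; α-antitone )
    open OrthomodularNearSemiringProperties R

  -- Equality of algebras on the same universe: all operations agree pointwise.

  infix 4 _≐ᴸ_ _≐ᴿ_

  record _≐ᴸ_ (L M : OrthomodularLattice S) : Set (c ⊔ ℓ) where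
    private
      module L = OrthomodularLattice L
      module M = OrthomodularLattice M
    field
      ∨-≈ : ∀ x y → (x L.∨ y) ≈ (x M.∨ y)
      ∧-≈ : ∀ x y → (x L.∧ y) ≈ (x M.∧ y)
      ′-≈ : ∀ x → (x L.′) ≈ (x M.′)
      ⊥-≈ : L.⊥ ≈ M.⊥
      ⊤-≈ : L.⊤ ≈ M.⊤

  record _≐ᴿ_ (R Q : OrthomodularNearSemiring S) : Set (c ⊔ ℓ) where
    private
      module R = OrthomodularNearSemiring R
      module Q = OrthomodularNearSemiring Q
    field
      +-≈  : ∀ x y → (x R.+ y) ≈ (x Q.+ y)
      *-≈  : ∀ x y → (x R.* y) ≈ (x Q.* y)
      α-≈  : ∀ x → R.α x ≈ Q.α x
      0#-≈ : R.0# ≈ Q.0#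
      1#-≈ : R.1# ≈ Q.1#

{-# OPTIONS --safe #-}
-- L ≐ 𝐋 (𝐑 L) is De Morgan's law for the meet.  For R ≐ 𝐑 (𝐋 R), put
-- u = x + α y.  Distributivity and α y * y ≈ 0 give x * y ≈ u * y.  Since
-- α y ≤ u, the Łukasiewicz identity makes u and y commute, so u * y lies below
-- both factors; and a common lower bound of u and y lies below u * y by
-- monotonicity and orthomodularity.  Hence u * y ≈ u ⊓ y.
module Submission where

open import Defs
open import Data.Product using (_×_; _,_)
open import Level using (Level)
open import Relation.Binary.Bundles using (Setoid)
import Relation.Binary.Reasoning.Setoid as SetoidReasoning

module _ {c ℓ : Level} {S : Setoid c ℓ} where

  open Setoid S using (_≈_; refl; sym; trans)
  open SetoidReasoning S

  module _ (L : OrthomodularLattice S) where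
    open OrthomodularLattice L
      using (_∨_; _∧_; _′; _≤_; ′-involutive; ′-antitone)
    open OrthomodularLatticeProperties L

    -- An antitone involution turns upper bounds into lower bounds, hence joins into meets.
    ∧-deMorgan : ∀ x y → x ∧ y ≈ (x ′ ∨ y ′) ′
    ∧-deMorgan x y = ≤-antisym
      (≤-swap (∨-least (′-antitone (x∧y≤x x y)) (′-antitone (x∧y≤y x y))))
      (∧-greatest (below (x≤x∨y (x ′) (y ′))) (below (y≤x∨y (x ′) (y ′))))
      where
      below : ∀ {u v} → u ′ ≤ v → v ′ ≤ u
      below u′≤v = ≤-trans (′-antitone u′≤v) (≤-reflexive (′-involutive _))

  module _ (R : OrthomodularNearSemiring S) where
    open OrthomodularNearSemiring R
      using (_+_; _*_; α; 0#; _≤_; *-cong; distribʳ; α-involutive)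
    open OrthomodularNearSemiringProperties R

    -- Writing `y` as `α (α y)` reduces this to `≤⇒*-comm` for `α y` and `u`.
    α≤⇒*-comm : ∀ {u y} → α y ≤ u → u * y ≈ y * u
    α≤⇒*-comm {u} {y} αy≤u = begin
      u * y        ≈⟨ *-cong refl (α-involutive y) ⟨
      u * α (α y)  ≈⟨ ≤⇒*-comm αy≤u ⟩
      α (α y) * u  ≈⟨ *-cong (α-involutive y) refl ⟩
      y * u        ∎

    α≤⇒*≈⊓ : ∀ {u y} → α y ≤ u → u * y ≈ u ⊓ y
    α≤⇒*≈⊓ {u} {y} αy≤u = ≤-antisym
      -- A product always lies below its right factor; commuting bounds it by the left one.
      (⊓-greatest (≤-trans (≤-reflexive (α≤⇒*-comm αy≤u)) (*≤ʳ y u)) (*≤ʳ u y))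
      -- Right multiplication by `y` fixes `u ⊓ y`, which lies below `y`.
      (≤-trans (≤-reflexive (sym (≤⇒* (⊓≤ʳ u y)))) (*-monoˡ y (⊓≤ˡ u y)))

    -- Allows any left factor of `y` to be replaced by one above `α y`.
    +α-absorb-* : ∀ x y → (x + α y) * y ≈ x * y
    +α-absorb-* x y = begin
      (x + α y) * y    ≈⟨ distribʳ y x (α y) ⟩
      x * y + α y * y  ≈⟨ ∙-congˡ (αx*x≈0 y) ⟩
      x * y + 0#       ≈⟨ identityʳ (x * y) ⟩
      x * y            ∎

    *≈sasaki : ∀ x y → x * y ≈ (x + α y) ⊓ y
    *≈sasaki x y = trans (sym (+α-absorb-* x y)) (α≤⇒*≈⊓ (y≤x∨y x (α y)))

theorem11 : ∀ {c ℓ : Level} (S : Setoid c ℓ) →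
    (∀ (L : OrthomodularLattice S) → L ≐ᴸ 𝐋 (𝐑 L)) ×
    (∀ (R : OrthomodularNearSemiring S) → R ≐ᴿ 𝐑 (𝐋 R))
theorem11 S =
  (λ L → record
    -- Both translations alter only the meet or the product, so the rest is `refl`.
    { ∨-≈ = λ _ _ → refl
    ; ∧-≈ = ∧-deMorgan L
    ; ′-≈ = λ _ → refl
    ; ⊥-≈ = refl
    ; ⊤-≈ = refl
    }) ,
  (λ R → record
    { +-≈  = λ _ _ → refl
    ; *-≈  = *≈sasaki R
    ; α-≈  = λ _ → refl
    ; 0#-≈ = refl
    ; 1#-≈ = refl
    })
  where open Setoid S using (refl)
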